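{- For every integer $n\ge 0$, \[ \binom{2n}{n}^3=[(xyz)^n]\,(1+x+y+z)^{2n}(1+x+y-z)^n(1+x-y+z)^n . \]
   Context: Here $x,y,z$ are indeterminates, and $[(xyz)^n]$ denotes the coefficient of the monomial $x^ny^nz^n$ in the polynomial that follows. -}

module Defs where

open import Algebra.Bundles.Raw using (RawRing)
import Algebra.Definitions.RawSemiring as RawSemiringDefinitions
open import Data.Bool.Base using (if_then_else_)
open import Data.Fin.Base using (Fin; zero; suc)
open import Data.Integer.Base as ℤ using (ℤ; 0ℤ; 1ℤ)
open import Data.List.Base using (List; []; _∷_; [_]; _++_; map; cartesianProductWith)
open import Data.Nat.Base as ℕ using (ℕ)
import Data.Nat.Properties as ℕ
open import Data.Product.Base using (_×_; _,_)
open import Data.Vec.Base using (Vec; replicate; zipWith; _[_]≔_)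
import Data.Vec.Properties as Vec
open import Level using (0ℓ)
open import Relation.Binary.Definitions using (DecidableEquality)
open import Relation.Binary.PropositionalEquality using (_≡_)
open import Relation.Nullary.Decidable using (does)

private
  variable
    k : ℕ

-- The monomial X₀^e₀ ⋯ X₍ₖ₋₁₎^e₍ₖ₋₁₎ is represented by its exponent vector.
Monomial : ℕ → Set
Monomial k = Vec ℕ k

_≟ᵐ_ : DecidableEquality (Monomial k)
_≟ᵐ_ = Vec.≡-dec ℕ._≟_

-- ℤ[X₀, …, X₍ₖ₋₁₎]: a list of terms stands for the sum of its terms.  Monomials
-- may repeat and coefficients may be 0, so the intended equality is _≈_ below,
-- not _≡_.
Poly : ℕ → Set
Poly k = List (ℤ × Monomial k)

coeff : Monomial k → Poly k → ℤ
coeff e []            = 0ℤ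
coeff e ((c , d) ∷ p) = (if does (d ≟ᵐ e) then c else 0ℤ) ℤ.+ coeff e p

infix  4 _≈_
infixl 6 _+_ _-_
infixl 7 _*_
infix  8 -_
infixr 8 _^_

_≈_ : Poly k → Poly k → Set
p ≈ q = ∀ e → coeff e p ≡ coeff e q

_+_ : Poly k → Poly k → Poly k
_+_ = _++_

-_ : Poly k → Poly k
-_ = map λ (c , d) → ℤ.- c , d

_-_ : Poly k → Poly k → Poly k
p - q = p + (- q)

_*ᵗ_ : ℤ × Monomial k → ℤ × Monomial k → ℤ × Monomial k
(c , d) *ᵗ (c′ , d′) = c ℤ.* c′ , zipWith ℕ._+_ d d′

_*_ : Poly k → Poly k → Poly k
_*_ = cartesianProductWith _*ᵗ_

0# : Poly k
0# = []

1# : Poly k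
1# {k} = [ 1ℤ , replicate k 0 ]

var : Fin k → Poly k
var {k} i = [ 1ℤ , replicate k 0 [ i ]≔ 1 ]

polyRawRing : ℕ → RawRing 0ℓ 0ℓ
polyRawRing k = record
  { Carrier = Poly k
  ; _≈_     = _≈_
  ; _+_     = _+_
  ; _*_     = _*_
  ; -_      = -_
  ; 0#      = 0#
  ; 1#      = 1#
  }

_^_ : Poly k → ℕ → Poly k
_^_ {k} = RawSemiringDefinitions._^_ (RawRing.rawSemiring (polyRawRing k))

x y z : Poly 3
x = var zero
y = var (suc zero)
z = var (suc (suc zero))

{-# OPTIONS --safe #-}
module Submission where

-- Put u = 1 + x, s = y + z and d = y - z.  The three linear forms are u + s,
-- u + d and u - d, so the polynomial of the theorem is
--
--     (u + s)²ⁿ (u² - d²)ⁿ.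
--
-- Consider first the coefficient of xⁿyⁿzⁿ in (u + s)²ⁿ u²ⁱ (-d²)ᵏ, where i + k = n.
-- In this monomial y and z have total degree 2n, of which (-d²)ᵏ supplies 2k, so
-- (u + s)²ⁿ must contribute its term C(2n,2i) u²ⁿ⁻²ⁱ s²ⁱ; the resulting u²ⁿ has
-- the coefficient C(2n,n) at xⁿ (coeff-[u+s]^*).  There remains the coefficient
-- T(i,k) of yⁿzⁿ in s²ⁱ (-d²)ᵏ.  Since s² - d² = 4yz, it satisfies
--
--     T(i,k+1) + T(i+1,k) = 4 T(i,k),     T(i,0) = C(2i,i),
--
-- whence T(i,k) = (2i)! (2k)! / (i! k! (i+k)!) by induction on k (diag-F), and so
-- C(2n,2i) T(i,k) = C(2n,n) C(n,k) (C-diag-F).  The coefficient in question is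
-- therefore C(2n,n)² C(n,k).
--
-- More generally, if i + k + m = n then the coefficient of xⁿyⁿzⁿ in
--
--     (u + s)²ⁿ u²ⁱ (-d²)ᵏ (u² - d²)ᵐ
--
-- is C(2n,n)² C(n+m,k+m), by induction on m (coeff-W): splitting off one factor
-- u² + (-d²) gives the cases (i+1,k) and (i,k+1) for m - 1, and their values add up
-- by Pascal's rule.  The theorem is the case i = k = 0, m = n.
--
-- Polynomials are compared by all linear functionals on monomials rather than by
-- coefficients alone: for that relation the commutative ring laws are immediate,
-- and it implies equality of coefficients.

open import Defs
open import Data.Integer.Base using (+_)
open import Data.Nat.Base as ℕ using (ℕ)
open import Data.Nat.Combinatorics using (_C_)
open import Data.Vec.Base using ([]; _∷_)
open import Relation.Binary.PropositionalEquality using (_≡_)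

open import Algebra.Bundles using (CommutativeRing)
import Algebra.Consequences.Setoid as Consequences
import Algebra.Properties.CommutativeSemiring.Exp as CommSemiringExp
import Algebra.Properties.Ring as RingProps
import Algebra.Properties.Semiring.Exp as SemiringExp
import Algebra.Solver.Ring.NaturalCoefficients.Default as NatSolver
import Data.Integer.Properties as ℤ
open import Algebra.Properties.CommutativeSemigroup ℤ.*-commutativeSemigroup using (x∙yz≈y∙xz)
open import Data.Bool.Base using (true; false; if_then_else_; _∧_)
open import Data.Fin.Base using (Fin; zero; suc)
open import Data.Integer.Base as ℤ using (ℤ; 0ℤ; 1ℤ)
open import Data.Integer.Tactic.RingSolver using (solve-∀)
open import Data.List.Base using ([]; _∷_; map)
import Data.List.Properties as List
open import Data.Nat.Base using (zero; suc; _!)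
open import Data.Nat.Combinatorics
  using (nCk≡n!/k![n-k]!; k![n∸k]!∣n!; nCn≡1; nCk+nC[k+1]≡[n+1]C[k+1])
open import Data.Nat.DivMod using (_/_; m/n*n≡m)
import Data.Nat.Properties as ℕ
import Data.Nat.Tactic.RingSolver as ℕ-Solver
open import Data.Product.Base using (_×_; _,_; proj₂)
open import Data.Vec.Base using (replicate; zipWith; lookup; _[_]≔_; _[_]%=_)
import Data.Vec.Properties as Vec
open import Function.Base using (_∘_; flip)
open import Level using (0ℓ)
open import Relation.Binary.Bundles using (Setoid)
open import Relation.Binary.PropositionalEquality
  using (refl; sym; trans; cong; cong₂; module ≡-Reasoning)
import Relation.Binary.Reasoning.Setoid as ≋-Reasoning
open import Relation.Binary.Structures using (IsEquivalence)
open import Relation.Nullary.Decidable using (does; dec-false)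
open import Relation.Nullary.Negation using (¬_; contradiction)

private
  variable
    k : ℕ

-- Linear functionals on polynomials

infixl 6 _∙_

-- The product of monomials.
_∙_ : Monomial k → Monomial k → Monomial k
_∙_ = zipWith ℕ._+_

-- The linear functional on polynomials with prescribed values on monomials.
ev : (Monomial k → ℤ) → Poly k → ℤ
ev L []            = 0ℤ
ev L ((c , d) ∷ p) = c ℤ.* L d ℤ.+ ev L p

infix 4 _≋_

-- Equality under every linear functional.  A record rather than a function type,
-- so that p and q can be inferred from p ≋ q.
record _≋_ (p q : Poly k) : Set where
  constructor by-functionals
  field
    functional : ∀ L → ev L p ≡ ev L q

open _≋_

ev-cong : {L L′ : Monomial k → ℤ} → (∀ d → L d ≡ L′ d) → ∀ p → ev L p ≡ ev L′ p
ev-cong L≗L′ []            = refl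
ev-cong L≗L′ ((c , d) ∷ p) =
  cong₂ ℤ._+_ (cong (c ℤ.*_) (L≗L′ d)) (ev-cong L≗L′ p)

ev-+ : ∀ (L : Monomial k → ℤ) p q → ev L (p + q) ≡ ev L p ℤ.+ ev L q
ev-+ L []            q = sym (ℤ.+-identityˡ _)
ev-+ L ((c , d) ∷ p) q =
  trans (cong (ℤ._+_ (c ℤ.* L d)) (ev-+ L p q)) (sym (ℤ.+-assoc (c ℤ.* L d) (ev L p) (ev L q)))

ev-neg : ∀ (L : Monomial k → ℤ) p → ev L (- p) ≡ ℤ.- ev L p
ev-neg L []            = refl
ev-neg L ((c , d) ∷ p) =
  trans (cong (ℤ._+_ (ℤ.- c ℤ.* L d)) (ev-neg L p)) (lemma c (L d) (ev L p))
  where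
  lemma : ∀ a b r → ℤ.- a ℤ.* b ℤ.+ ℤ.- r ≡ ℤ.- (a ℤ.* b ℤ.+ r)
  lemma = solve-∀

ev-*ᵗ : ∀ (L : Monomial k → ℤ) c d q →
        ev L (map ((c , d) *ᵗ_) q) ≡ c ℤ.* ev (λ d′ → L (d ∙ d′)) q
ev-*ᵗ L c d []              = sym (ℤ.*-zeroʳ c)
ev-*ᵗ L c d ((c′ , d′) ∷ q) =
  trans (cong (ℤ._+_ (c ℤ.* c′ ℤ.* L (d ∙ d′))) (ev-*ᵗ L c d q))
        (lemma c c′ (L (d ∙ d′)) (ev (λ d′ → L (d ∙ d′)) q))
  where
  lemma : ∀ a b t r → a ℤ.* b ℤ.* t ℤ.+ a ℤ.* r ≡ a ℤ.* (b ℤ.* t ℤ.+ r)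
  lemma = solve-∀

ev-* : ∀ (L : Monomial k → ℤ) p q →
       ev L (p * q) ≡ ev (λ d → ev (λ d′ → L (d ∙ d′)) q) p
ev-* L []            q = refl
ev-* L ((c , d) ∷ p) q =
  trans (ev-+ L (map ((c , d) *ᵗ_) q) (p * q)) (cong₂ ℤ._+_ (ev-*ᵗ L c d q) (ev-* L p q))

ev-0 : ∀ (p : Poly k) → ev (λ _ → 0ℤ) p ≡ 0ℤ
ev-0 []            = refl
ev-0 ((c , d) ∷ p) = cong₂ ℤ._+_ (ℤ.*-zeroʳ c) (ev-0 p)

ev-linear : ∀ c (L M : Monomial k → ℤ) p →
            ev (λ d → c ℤ.* L d ℤ.+ M d) p ≡ c ℤ.* ev L p ℤ.+ ev M p
ev-linear c L M []            = lemma c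
  where
  lemma : ∀ c → 0ℤ ≡ c ℤ.* 0ℤ ℤ.+ 0ℤ
  lemma = solve-∀
ev-linear c L M ((a , d) ∷ p) =
  trans (cong (ℤ._+_ (a ℤ.* (c ℤ.* L d ℤ.+ M d))) (ev-linear c L M p))
        (lemma a c (L d) (M d) (ev L p) (ev M p))
  where
  lemma : ∀ a c l m r s → a ℤ.* (c ℤ.* l ℤ.+ m) ℤ.+ (c ℤ.* r ℤ.+ s)
                        ≡ c ℤ.* (a ℤ.* l ℤ.+ r) ℤ.+ (a ℤ.* m ℤ.+ s)
  lemma = solve-∀

-- Interchange of two finite sums.
ev-swap : ∀ (F : Monomial k → Monomial k → ℤ) p q →
          ev (λ d → ev (F d) q) p ≡ ev (λ d′ → ev (λ d → F d d′) p) q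
ev-swap F []            q = sym (ev-0 q)
ev-swap F ((c , d) ∷ p) q =
  trans (cong (ℤ._+_ (c ℤ.* ev (F d) q)) (ev-swap F p q))
        (sym (ev-linear c (F d) (λ d′ → ev (λ d → F d d′) p) q))

-- The ring of polynomials up to equality under every functional

≋-isEquivalence : IsEquivalence (_≋_ {k})
≋-isEquivalence = record
  { refl  = by-functionals λ L → refl
  ; sym   = λ p≋q → by-functionals λ L → sym (functional p≋q L)
  ; trans = λ p≋q q≋r → by-functionals λ L → trans (functional p≋q L) (functional q≋r L)
  }

*-cong : {p p′ q q′ : Poly k} → p ≋ p′ → q ≋ q′ → p * q ≋ p′ * q′
*-cong {p = p} {p′} {q} {q′} p≋p′ q≋q′ = by-functionals λ L → begin
  ev L (p * q)                              ≡⟨ ev-* L p q ⟩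
  ev (λ d → ev (λ d′ → L (d ∙ d′)) q) p     ≡⟨ ev-cong (λ d → functional q≋q′ (λ d′ → L (d ∙ d′))) p ⟩
  ev (λ d → ev (λ d′ → L (d ∙ d′)) q′) p    ≡⟨ functional p≋p′ _ ⟩
  ev (λ d → ev (λ d′ → L (d ∙ d′)) q′) p′   ≡⟨ ev-* L p′ q′ ⟨
  ev L (p′ * q′)                            ∎
  where open ≡-Reasoning

*-comm : ∀ (p q : Poly k) → p * q ≋ q * p
*-comm p q = by-functionals λ L → begin
  ev L (p * q)                            ≡⟨ ev-* L p q ⟩
  ev (λ d → ev (λ d′ → L (d ∙ d′)) q) p   ≡⟨ ev-swap (λ d d′ → L (d ∙ d′)) p q ⟩
  ev (λ d′ → ev (λ d → L (d ∙ d′)) p) q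
    ≡⟨ ev-cong (λ d′ → ev-cong (λ d → cong L (Vec.zipWith-comm ℕ.+-comm d d′)) p) q ⟩
  ev (λ d′ → ev (λ d → L (d′ ∙ d)) p) q   ≡⟨ ev-* L q p ⟨
  ev L (q * p)                            ∎
  where open ≡-Reasoning

*-assoc : ∀ (p q r : Poly k) → (p * q) * r ≋ p * (q * r)
*-assoc p q r = by-functionals λ L → begin
  ev L ((p * q) * r)                                                ≡⟨ ev-* L (p * q) r ⟩
  ev (λ a → ev (λ c → L (a ∙ c)) r) (p * q)                         ≡⟨ ev-* _ p q ⟩
  ev (λ a → ev (λ b → ev (λ c → L ((a ∙ b) ∙ c)) r) q) p
    ≡⟨ ev-cong (λ a → ev-cong (λ b → ev-cong (λ c →
         cong L (Vec.zipWith-assoc ℕ.+-assoc a b c)) r) q) p ⟩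
  ev (λ a → ev (λ b → ev (λ c → L (a ∙ (b ∙ c))) r) q) p            ≡⟨ ev-cong (λ a → ev-* _ q r) p ⟨
  ev (λ a → ev (λ b → L (a ∙ b)) (q * r)) p                         ≡⟨ ev-* L p (q * r) ⟨
  ev L (p * (q * r))                                                ∎
  where open ≡-Reasoning

1*a+0≡a : ∀ a → 1ℤ ℤ.* a ℤ.+ 0ℤ ≡ a
1*a+0≡a = solve-∀

*-identityˡ : ∀ (p : Poly k) → 1# * p ≋ p
*-identityˡ p = by-functionals λ L → begin
  ev L (1# * p)                                       ≡⟨ ev-* L 1# p ⟩
  1ℤ ℤ.* ev (λ d → L (replicate _ 0 ∙ d)) p ℤ.+ 0ℤ    ≡⟨ 1*a+0≡a _ ⟩
  ev (λ d → L (replicate _ 0 ∙ d)) p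
    ≡⟨ ev-cong (λ d → cong L (Vec.zipWith-identityˡ ℕ.+-identityˡ d)) p ⟩
  ev L p                                              ∎
  where open ≡-Reasoning

+-cong : {p p′ q q′ : Poly k} → p ≋ p′ → q ≋ q′ → p + q ≋ p′ + q′
+-cong {p = p} {p′} {q} {q′} p≋p′ q≋q′ = by-functionals λ L →
  trans (ev-+ L p q)
    (trans (cong₂ ℤ._+_ (functional p≋p′ L) (functional q≋q′ L)) (sym (ev-+ L p′ q′)))

+-assoc : ∀ (p q r : Poly k) → (p + q) + r ≋ p + (q + r)
+-assoc p q r = by-functionals λ L → cong (ev L) (List.++-assoc p q r)

+-comm : ∀ (p q : Poly k) → p + q ≋ q + p
+-comm p q = by-functionals λ L →
  trans (ev-+ L p q) (trans (ℤ.+-comm (ev L p) (ev L q)) (sym (ev-+ L q p)))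

-‿cong : {p q : Poly k} → p ≋ q → - p ≋ - q
-‿cong {p = p} {q} p≋q = by-functionals λ L →
  trans (ev-neg L p) (trans (cong ℤ.-_ (functional p≋q L)) (sym (ev-neg L q)))

-‿inverseʳ : ∀ (p : Poly k) → p + - p ≋ 0#
-‿inverseʳ p = by-functionals λ L →
  trans (ev-+ L p (- p)) (trans (cong (ℤ._+_ (ev L p)) (ev-neg L p)) (ℤ.+-inverseʳ (ev L p)))

*-distribʳ-+ : ∀ (r p q : Poly k) → (p + q) * r ≋ p * r + q * r
*-distribʳ-+ r p q = by-functionals λ L →
  let M = λ d → ev (λ d′ → L (d ∙ d′)) r in begin
  ev L ((p + q) * r)                   ≡⟨ ev-* L (p + q) r ⟩
  ev M (p + q)                         ≡⟨ ev-+ M p q ⟩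
  ev M p ℤ.+ ev M q                    ≡⟨ cong₂ ℤ._+_ (ev-* L p r) (ev-* L q r) ⟨
  ev L (p * r) ℤ.+ ev L (q * r)        ≡⟨ ev-+ L (p * r) (q * r) ⟨
  ev L (p * r + q * r)                 ∎
  where open ≡-Reasoning

≋-setoid : ℕ → Setoid 0ℓ 0ℓ
≋-setoid k = record { isEquivalence = ≋-isEquivalence {k} }

polyRing : ℕ → CommutativeRing 0ℓ 0ℓ
polyRing k = record
  { Carrier = Poly k
  ; _≈_ = _≋_
  ; _+_ = _+_
  ; _*_ = _*_
  ; -_  = -_
  ; 0#  = 0#
  ; 1#  = 1#
  ; isCommutativeRing = record
    { isRing = record
      { +-isAbelianGroup = record
        { isGroup = record
          { isMonoid = record
            { isSemigroup = record
              { isMagma = record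
                { isEquivalence = ≋-isEquivalence
                ; ∙-cong = +-cong
                }
              ; assoc = +-assoc
              }
            ; identity = comm∧idˡ⇒id +-comm {0#} (λ p → by-functionals λ L → refl)
            }
          ; inverse = comm∧invʳ⇒inv {_⁻¹ = -_} {0#} +-comm -‿inverseʳ
          ; ⁻¹-cong = -‿cong
          }
        ; comm = +-comm
        }
      ; *-cong = *-cong
      ; *-assoc = *-assoc
      ; *-identity = comm∧idˡ⇒id *-comm {1#} *-identityˡ
      ; distrib = comm∧distrʳ⇒distr +-cong *-comm *-distribʳ-+
      }
    ; *-comm = *-comm
    }
  }
  where
  open Consequences (≋-setoid k)

open module PolyRing {k : ℕ} = CommutativeRing (polyRing k)
  using (*-identityʳ; +-identityʳ; zeroʳ)
  renaming (refl to ≋-refl; sym to ≋-sym; trans to ≋-trans)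

open module RingProperties {k : ℕ} =
  RingProps (CommutativeRing.ring (polyRing k)) using (-‿distribˡ-*; -‿distribʳ-*)

open module RingSolver {k : ℕ} =
  NatSolver (CommutativeRing.commutativeSemiring (polyRing k)) using (solve; _:+_; _:*_; _:=_)

module Exp {k : ℕ} = SemiringExp (CommutativeRing.semiring (polyRing k))
module CommExp {k : ℕ} = CommSemiringExp (CommutativeRing.commutativeSemiring (polyRing k))

*-congˡ : ∀ (p : Poly k) {q r} → q ≋ r → p * q ≋ p * r
*-congˡ p q≋r = *-cong (≋-refl {x = p}) q≋r

*-congʳ : ∀ (p : Poly k) {q r} → q ≋ r → q * p ≋ r * p
*-congʳ p q≋r = *-cong q≋r (≋-refl {x = p})

≡⇒≋ : {p q : Poly k} → p ≡ q → p ≋ q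
≡⇒≋ refl = ≋-refl

-- The two powers are defined over raw rings with different equalities, so they
-- agree definitionally only for a literal exponent.
^≡Exp^ : ∀ (p : Poly k) n → p ^ n ≡ p Exp.^ n
^≡Exp^ p zero    = refl
^≡Exp^ p (suc n) = cong (p *_) (^≡Exp^ p n)

^-congˡ : ∀ n {p q : Poly k} → p ≋ q → p ^ n ≋ q ^ n
^-congˡ n {p} {q} p≋q rewrite ^≡Exp^ p n | ^≡Exp^ q n = Exp.^-congˡ n p≋q

^-assocʳ : ∀ (p : Poly k) m n → (p ^ m) ^ n ≋ p ^ (m ℕ.* n)
^-assocʳ p m n rewrite ^≡Exp^ (p ^ m) n | ^≡Exp^ p m | ^≡Exp^ p (m ℕ.* n) = Exp.^-assocʳ p m n

^-distrib-* : ∀ (p q : Poly k) n → (p * q) ^ n ≋ p ^ n * q ^ n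
^-distrib-* p q n rewrite ^≡Exp^ (p * q) n | ^≡Exp^ p n | ^≡Exp^ q n = CommExp.^-distrib-* p q n

-- Polynomial identities

difference-of-squares : ∀ (p q : Poly k) → (p + q) * (p - q) ≋ p ^ 2 - q ^ 2
difference-of-squares p q = begin
  (p + q) * (p - q)
    ≈⟨ solve 3 (λ p q r → (p :+ q) :* (p :+ r) := (p :* p :+ q :* r) :+ p :* (q :+ r)) ≋-refl p q (- q) ⟩
  (p * p + q * - q) + p * (q - q)
    ≈⟨ +-cong (+-cong (*-congˡ p (≋-sym (*-identityʳ p))) q*-q)
               (≋-trans (*-congˡ p (-‿inverseʳ q)) (zeroʳ p)) ⟩
  (p ^ 2 - q ^ 2) + 0#
    ≈⟨ +-identityʳ _ ⟩
  p ^ 2 - q ^ 2 ∎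
  where
  open ≋-Reasoning (≋-setoid _)
  q*-q : q * - q ≋ - (q ^ 2)
  q*-q = ≋-trans (≋-sym (-‿distribʳ-* q q)) (-‿cong (*-congˡ q (≋-sym (*-identityʳ q))))

[p+q]²-[p-q]²≋4pq : ∀ (p q : Poly k) →
  (p + q) ^ 2 - (p - q) ^ 2 ≋ (p * q + p * q) + (p * q + p * q)
[p+q]²-[p-q]²≋4pq p q = begin
  (p + q) ^ 2 - (p - q) ^ 2
    ≈⟨ difference-of-squares (p + q) (p - q) ⟨
  ((p + q) + (p - q)) * ((p + q) - (p - q))
    ≈⟨ *-cong sum difference ⟩
  (p + p) * (q + q)
    ≈⟨ solve 2 (λ p q → (p :+ p) :* (q :+ q) := (p :* q :+ p :* q) :+ (p :* q :+ p :* q)) ≋-refl p q ⟩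
  (p * q + p * q) + (p * q + p * q) ∎
  where
  open ≋-Reasoning (≋-setoid _)
  sum : (p + q) + (p - q) ≋ p + p
  sum = begin
    (p + q) + (p - q)
      ≈⟨ solve 3 (λ p q r → (p :+ q) :+ (p :+ r) := (p :+ p) :+ (q :+ r)) ≋-refl p q (- q) ⟩
    (p + p) + (q - q)   ≈⟨ +-cong (≋-refl {x = p + p}) (-‿inverseʳ q) ⟩
    (p + p) + 0#        ≈⟨ +-identityʳ _ ⟩
    p + p               ∎
  shift : (q + q) + (p - q) ≋ p + q
  shift = begin
    (q + q) + (p - q)
      ≈⟨ solve 3 (λ p q r → (q :+ q) :+ (p :+ r) := (p :+ q) :+ (q :+ r)) ≋-refl p q (- q) ⟩
    (p + q) + (q - q)   ≈⟨ +-cong (≋-refl {x = p + q}) (-‿inverseʳ q) ⟩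
    (p + q) + 0#        ≈⟨ +-identityʳ _ ⟩
    p + q               ∎
  difference : (p + q) - (p - q) ≋ q + q
  difference = begin
    (p + q) - (p - q)               ≈⟨ +-cong shift (≋-refl {x = - (p - q)}) ⟨
    (q + q) + (p - q) - (p - q)     ≈⟨ +-assoc (q + q) (p - q) (- (p - q)) ⟩
    (q + q) + ((p - q) - (p - q))   ≈⟨ +-cong (≋-refl {x = q + q}) (-‿inverseʳ (p - q)) ⟩
    (q + q) + 0#                    ≈⟨ +-identityʳ _ ⟩
    q + q                           ∎

[u+s]P-split : ∀ (u s P a p : Poly k) → ((u + s) * P) * (a * p) ≋ P * ((u * a) * p) + P * (a * (s * p))
[u+s]P-split = solve 5 (λ u s P a p →
  ((u :+ s) :* P) :* (a :* p) := P :* ((u :* a) :* p) :+ P :* (a :* (s :* p))) ≋-refl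

[u+f]c-split : ∀ (u f P a b c : Poly k) →
  P * (a * b * ((u + f) * c)) ≋ P * ((u * a) * b * c) + P * (a * (f * b) * c)
[u+f]c-split = solve 6 (λ u f P a b c →
  P :* (a :* b :* ((u :+ f) :* c)) := P :* ((u :* a) :* b :* c) :+ P :* (a :* (f :* b) :* c)) ≋-refl

q+f-collect : ∀ (q f a b : Poly k) → a * (f * b) + (q * a) * b ≋ (q + f) * (a * b)
q+f-collect = solve 4 (λ q f a b → a :* (f :* b) :+ (q :* a) :* b := (q :+ f) :* (a :* b)) ≋-refl

-- Coefficients of sums, negatives and monomial multiples

-- The functional that takes the coefficient at e.
δ : Monomial k → Monomial k → ℤ
δ e d = if does (d ≟ᵐ e) then 1ℤ else 0ℤ

coeff≡ev-δ : ∀ (e : Monomial k) p → coeff e p ≡ ev (δ e) p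
coeff≡ev-δ e []            = refl
coeff≡ev-δ e ((c , d) ∷ p) = cong₂ ℤ._+_ (lemma (does (d ≟ᵐ e))) (coeff≡ev-δ e p)
  where
  lemma : ∀ b → (if b then c else 0ℤ) ≡ c ℤ.* (if b then 1ℤ else 0ℤ)
  lemma true  = sym (ℤ.*-identityʳ c)
  lemma false = sym (ℤ.*-zeroʳ c)

coeff-cong : ∀ (e : Monomial k) {p q} → p ≋ q → coeff e p ≡ coeff e q
coeff-cong e {p} {q} p≋q =
  trans (coeff≡ev-δ e p) (trans (functional p≋q (δ e)) (sym (coeff≡ev-δ e q)))

coeff-+ : ∀ (e : Monomial k) p q → coeff e (p + q) ≡ coeff e p ℤ.+ coeff e q
coeff-+ e p q = begin
  coeff e (p + q)                  ≡⟨ coeff≡ev-δ e (p + q) ⟩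
  ev (δ e) (p + q)                 ≡⟨ ev-+ (δ e) p q ⟩
  ev (δ e) p ℤ.+ ev (δ e) q        ≡⟨ cong₂ ℤ._+_ (coeff≡ev-δ e p) (coeff≡ev-δ e q) ⟨
  coeff e p ℤ.+ coeff e q          ∎
  where open ≡-Reasoning

coeff-neg : ∀ (e : Monomial k) p → coeff e (- p) ≡ ℤ.- coeff e p
coeff-neg e p = begin
  coeff e (- p)       ≡⟨ coeff≡ev-δ e (- p) ⟩
  ev (δ e) (- p)      ≡⟨ ev-neg (δ e) p ⟩
  ℤ.- ev (δ e) p      ≡⟨ cong ℤ.-_ (coeff≡ev-δ e p) ⟨
  ℤ.- coeff e p       ∎
  where open ≡-Reasoning

-- Multiplying by var i increments the i-th exponent.
unit-∙ : ∀ (i : Fin k) d → (replicate k 0 [ i ]≔ 1) ∙ d ≡ d [ i ]%= suc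
unit-∙ zero    (a ∷ d) = cong (suc a ∷_) (Vec.zipWith-identityˡ ℕ.+-identityˡ d)
unit-∙ (suc i) (a ∷ d) = cong (a ∷_) (unit-∙ i d)

δ-suc : ∀ (i : Fin k) e d → δ (e [ i ]%= suc) (d [ i ]%= suc) ≡ δ e d
δ-suc i e d = cong (if_then 1ℤ else 0ℤ) (go i e d)
  where
  go : ∀ {k} (i : Fin k) (e d : Monomial k) →
       does ((d [ i ]%= suc) ≟ᵐ (e [ i ]%= suc)) ≡ does (d ≟ᵐ e)
  go zero    (a ∷ e) (b ∷ d) = refl
  go (suc i) (a ∷ e) (b ∷ d) = cong (does (b ℕ.≟ a) ∧_) (go i e d)

δ-zero : ∀ (i : Fin k) e d → lookup e i ≡ 0 → δ e (d [ i ]%= suc) ≡ 0ℤ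
δ-zero i e d eᵢ≡0 = cong (if_then 1ℤ else 0ℤ) (dec-false ((d [ i ]%= suc) ≟ᵐ e) λ eq →
  ℕ.1+n≢0 (trans (sym (Vec.lookup∘updateAt i d)) (trans (cong (flip lookup i) eq) eᵢ≡0)))

ev-var* : ∀ (L : Monomial k → ℤ) i p → ev L (var i * p) ≡ ev (λ d → L (d [ i ]%= suc)) p
ev-var* L i p = begin
  ev L (var i * p)                                         ≡⟨ ev-* L (var i) p ⟩
  1ℤ ℤ.* ev (λ d → L ((replicate _ 0 [ i ]≔ 1) ∙ d)) p ℤ.+ 0ℤ   ≡⟨ 1*a+0≡a _ ⟩
  ev (λ d → L ((replicate _ 0 [ i ]≔ 1) ∙ d)) p            ≡⟨ ev-cong (λ d → cong L (unit-∙ i d)) p ⟩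
  ev (λ d → L (d [ i ]%= suc)) p                           ∎
  where open ≡-Reasoning

coeff-var*-suc : ∀ (e : Monomial k) i p → coeff (e [ i ]%= suc) (var i * p) ≡ coeff e p
coeff-var*-suc e i p = begin
  coeff (e [ i ]%= suc) (var i * p)                 ≡⟨ coeff≡ev-δ _ (var i * p) ⟩
  ev (δ (e [ i ]%= suc)) (var i * p)                ≡⟨ ev-var* _ i p ⟩
  ev (λ d → δ (e [ i ]%= suc) (d [ i ]%= suc)) p    ≡⟨ ev-cong (δ-suc i e) p ⟩
  ev (δ e) p                                        ≡⟨ coeff≡ev-δ e p ⟨
  coeff e p                                         ∎
  where open ≡-Reasoning

coeff-var*-zero : ∀ (e : Monomial k) i p → lookup e i ≡ 0 → coeff e (var i * p) ≡ 0ℤ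
coeff-var*-zero e i p eᵢ≡0 = begin
  coeff e (var i * p)                 ≡⟨ coeff≡ev-δ e (var i * p) ⟩
  ev (δ e) (var i * p)                ≡⟨ ev-var* _ i p ⟩
  ev (λ d → δ e (d [ i ]%= suc)) p    ≡⟨ ev-cong (λ d → δ-zero i e d eᵢ≡0) p ⟩
  ev (λ _ → 0ℤ) p                     ≡⟨ ev-0 p ⟩
  0ℤ                                  ∎
  where open ≡-Reasoning

-- Polynomials in x, y, z: forms in y and z

infix 10 [x^_y^_z^_]_

-- The coefficient of a monomial in x, y, z.
[x^_y^_z^_]_ : ℕ → ℕ → ℕ → Poly 3 → ℤ
[x^ a y^ b z^ c ] p = coeff (a ∷ b ∷ c ∷ []) p

u s d -d² : Poly 3
u = 1# + x
s = y + z
d = y - z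
-d² = - (d ^ 2)

-- A form of degree j in y and z: every monomial with a nonzero coefficient is free
-- of x and has total degree j.
record IsForm (j : ℕ) (p : Poly 3) : Set where
  constructor is-form
  field
    vanishes : ∀ a b c → ¬ (a ≡ 0 × b ℕ.+ c ≡ j) → [x^ a y^ b z^ c ] p ≡ 0ℤ

open IsForm

form-cong : ∀ {j p q} → p ≋ q → IsForm j p → IsForm j q
form-cong p≋q p-form = is-form λ a b c ≢j →
  trans (sym (coeff-cong _ p≋q)) (vanishes p-form a b c ≢j)

form-1 : IsForm 0 1#
form-1 = is-form λ where
  zero    zero    zero    ≢0 → contradiction (refl , refl) ≢0
  zero    zero    (suc c) _  → refl
  zero    (suc b) c       _  → refl
  (suc a) b       c       _  → refl

form-+ : ∀ {j p q} → IsForm j p → IsForm j q → IsForm j (p + q)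
form-+ {p = p} {q} p-form q-form = is-form λ a b c ≢j →
  trans (coeff-+ _ p q) (cong₂ ℤ._+_ (vanishes p-form a b c ≢j) (vanishes q-form a b c ≢j))

form-neg : ∀ {j p} → IsForm j p → IsForm j (- p)
form-neg {p = p} p-form = is-form λ a b c ≢j →
  trans (coeff-neg _ p) (cong ℤ.-_ (vanishes p-form a b c ≢j))

form-y* : ∀ {j p} → IsForm j p → IsForm (suc j) (y * p)
form-y* {p = p} p-form = is-form λ where
  a zero    c ≢j → coeff-var*-zero _ (suc zero) p refl
  a (suc b) c ≢j → trans (coeff-var*-suc (a ∷ b ∷ c ∷ []) (suc zero) p)
    (vanishes p-form a b c λ (a≡0 , b+c≡j) → ≢j (a≡0 , cong suc b+c≡j))

form-z* : ∀ {j p} → IsForm j p → IsForm (suc j) (z * p)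
form-z* {p = p} p-form = is-form λ where
  a b zero    ≢j → coeff-var*-zero _ (suc (suc zero)) p refl
  a b (suc c) ≢j → trans (coeff-var*-suc (a ∷ b ∷ c ∷ []) (suc (suc zero)) p)
    (vanishes p-form a b c λ (a≡0 , b+c≡j) → ≢j (a≡0 , trans (ℕ.+-suc b c) (cong suc b+c≡j)))

form-s* : ∀ {j p} → IsForm j p → IsForm (suc j) (s * p)
form-s* {p = p} p-form = form-cong (≋-sym (*-distribʳ-+ p y z)) (form-+ (form-y* p-form) (form-z* p-form))

form-d* : ∀ {j p} → IsForm j p → IsForm (suc j) (d * p)
form-d* {p = p} p-form = form-cong
  (≋-sym (≋-trans (*-distribʳ-+ p y (- z)) (+-cong (≋-refl {x = y * p}) (≋-sym (-‿distribˡ-* z p)))))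
  (form-+ (form-y* p-form) (form-neg (form-z* p-form)))

form-d²* : ∀ {j p} → IsForm j p → IsForm (2 ℕ.+ j) (-d² * p)
form-d²* {p = p} p-form = form-cong (≋-sym -d²*p) (form-neg (form-d* (form-d* p-form)))
  where
  -d²*p : -d² * p ≋ - (d * (d * p))
  -d²*p = ≋-trans (≋-sym (-‿distribˡ-* (d ^ 2) p))
    (-‿cong (≋-trans (*-congʳ p (*-congˡ d (*-identityʳ d))) (*-assoc d d p)))

-- Doubles are written k * 2, since suc k * 2 reduces to 2 + k * 2.
form-d²^ : ∀ k → IsForm (k ℕ.* 2) (-d² ^ k)
form-d²^ zero    = form-1
form-d²^ (suc k) = form-d²* (form-d²^ k)

-- Coefficients of a power of u or u + s times a form

coeff-u* : ∀ a b c p →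
  [x^ a y^ b z^ c ] (u * p) ≡ [x^ a y^ b z^ c ] p ℤ.+ [x^ a y^ b z^ c ] (x * p)
coeff-u* a b c p = trans (coeff-cong _ (*-distribʳ-+ p 1# x))
  (trans (coeff-+ _ (1# * p) (x * p))
    (cong (ℤ._+ [x^ a y^ b z^ c ] (x * p)) (coeff-cong _ (*-identityˡ p))))

-- [xᵃ] uⁿ = C(n,a), and a form is free of x.
coeff-u^* : ∀ {j p} → IsForm j p → ∀ n a b c →
  [x^ a y^ b z^ c ] (u ^ n * p) ≡ + (n C a) ℤ.* [x^ 0 y^ b z^ c ] p
coeff-u^* {p = p} p-form zero zero b c =
  trans (coeff-cong _ (*-identityˡ p)) (sym (ℤ.*-identityˡ _))
coeff-u^* {p = p} p-form zero (suc a) b c =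
  trans (coeff-cong _ (*-identityˡ p)) (vanishes p-form (suc a) b c λ ())
coeff-u^* {p = p} p-form (suc n) zero b c = begin
  [x^ 0 y^ b z^ c ] (u * u ^ n * p)                 ≡⟨ coeff-cong _ (*-assoc u (u ^ n) p) ⟩
  [x^ 0 y^ b z^ c ] (u * (u ^ n * p))               ≡⟨ coeff-u* 0 b c (u ^ n * p) ⟩
  [x^ 0 y^ b z^ c ] (u ^ n * p) ℤ.+ [x^ 0 y^ b z^ c ] (x * (u ^ n * p))
    ≡⟨ cong₂ ℤ._+_ (coeff-u^* p-form n 0 b c) (coeff-var*-zero _ zero (u ^ n * p) refl) ⟩
  1ℤ ℤ.* [x^ 0 y^ b z^ c ] p ℤ.+ 0ℤ                 ≡⟨ ℤ.+-identityʳ _ ⟩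
  1ℤ ℤ.* [x^ 0 y^ b z^ c ] p                        ∎
  where open ≡-Reasoning
coeff-u^* {p = p} p-form (suc n) (suc a) b c = begin
  [x^ suc a y^ b z^ c ] (u * u ^ n * p)             ≡⟨ coeff-cong _ (*-assoc u (u ^ n) p) ⟩
  [x^ suc a y^ b z^ c ] (u * (u ^ n * p))           ≡⟨ coeff-u* (suc a) b c (u ^ n * p) ⟩
  [x^ suc a y^ b z^ c ] (u ^ n * p) ℤ.+ [x^ suc a y^ b z^ c ] (x * (u ^ n * p))
    ≡⟨ cong₂ ℤ._+_ (coeff-u^* p-form n (suc a) b c)
         (trans (coeff-var*-suc (a ∷ b ∷ c ∷ []) zero (u ^ n * p)) (coeff-u^* p-form n a b c)) ⟩
  + (n C suc a) ℤ.* P ℤ.+ + (n C a) ℤ.* P           ≡⟨ ℤ.*-distribʳ-+ P (+ (n C suc a)) (+ (n C a)) ⟨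
  + (n C suc a ℕ.+ n C a) ℤ.* P
    ≡⟨ cong (λ m → + m ℤ.* P) (trans (ℕ.+-comm (n C suc a) (n C a)) (nCk+nC[k+1]≡[n+1]C[k+1] n a)) ⟩
  + (suc n C suc a) ℤ.* P                           ∎
  where
  open ≡-Reasoning
  P = [x^ 0 y^ b z^ c ] p

split-u+s : ∀ N a p → (u + s) ^ suc N * (u ^ a * p)
                    ≋ (u + s) ^ N * (u ^ suc a * p) + (u + s) ^ N * (u ^ a * (s * p))
split-u+s N a p = [u+s]P-split u s ((u + s) ^ N) (u ^ a) p

-- Multiplying a form of degree j by powers of u and u + s produces no term of
-- degree below j in y and z.
coeff-below : ∀ {j p} → IsForm j p → ∀ N n a b c → b ℕ.+ c ℕ.< j →
  [x^ a y^ b z^ c ] ((u + s) ^ N * (u ^ n * p)) ≡ 0ℤ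
coeff-below {p = p} p-form zero n a b c b+c<j = begin
  [x^ a y^ b z^ c ] (1# * (u ^ n * p))     ≡⟨ coeff-cong _ (*-identityˡ (u ^ n * p)) ⟩
  [x^ a y^ b z^ c ] (u ^ n * p)            ≡⟨ coeff-u^* p-form n a b c ⟩
  + (n C a) ℤ.* [x^ 0 y^ b z^ c ] p
    ≡⟨ cong (+ (n C a) ℤ.*_) (vanishes p-form 0 b c (ℕ.<⇒≢ b+c<j ∘ proj₂)) ⟩
  + (n C a) ℤ.* 0ℤ                         ≡⟨ ℤ.*-zeroʳ (+ (n C a)) ⟩
  0ℤ                                       ∎
  where open ≡-Reasoning
coeff-below {p = p} p-form (suc N) n a b c b+c<j =
  trans (coeff-cong _ (split-u+s N n p))
    (trans (coeff-+ _ ((u + s) ^ N * (u ^ suc n * p)) ((u + s) ^ N * (u ^ n * (s * p))))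
      (cong₂ ℤ._+_ (coeff-below p-form N (suc n) a b c b+c<j)
                   (coeff-below (form-s* p-form) N n a b c (ℕ.m<n⇒m<1+n b+c<j))))

-- The form p has degree j, so a monomial of degree m + j in y and z can only arise
-- from the term C(N,m) uᴺ⁻ᵐ sᵐ of (u + s)ᴺ.  The exponent n′ = n + N - m of u is
-- given by an equation in order to avoid truncated subtraction; for m > N both
-- sides vanish.
coeff-[u+s]^* : ∀ {j p} → IsForm j p → ∀ N n m n′ a b c →
  b ℕ.+ c ≡ m ℕ.+ j → n′ ℕ.+ m ≡ n ℕ.+ N →
  [x^ a y^ b z^ c ] ((u + s) ^ N * (u ^ n * p))
    ≡ + (N C m) ℤ.* (+ (n′ C a) ℤ.* [x^ 0 y^ b z^ c ] (s ^ m * p))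
coeff-[u+s]^* {p = p} p-form zero n zero n′ a b c b+c≡j n′≡n = begin
  [x^ a y^ b z^ c ] (1# * (u ^ n * p))     ≡⟨ coeff-cong _ (*-identityˡ (u ^ n * p)) ⟩
  [x^ a y^ b z^ c ] (u ^ n * p)            ≡⟨ coeff-u^* p-form n a b c ⟩
  + (n C a) ℤ.* [x^ 0 y^ b z^ c ] p
    ≡⟨ cong₂ (λ l r → + (l C a) ℤ.* r) n≡n′ (coeff-cong _ (≋-sym (*-identityˡ p))) ⟩
  + (n′ C a) ℤ.* [x^ 0 y^ b z^ c ] (1# * p)  ≡⟨ ℤ.*-identityˡ _ ⟨
  1ℤ ℤ.* (+ (n′ C a) ℤ.* [x^ 0 y^ b z^ c ] (1# * p))  ∎
  where
  open ≡-Reasoning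
  n≡n′ = trans (sym (ℕ.+-identityʳ n)) (trans (sym n′≡n) (ℕ.+-identityʳ n′))
coeff-[u+s]^* {j} {p} p-form zero n (suc m) n′ a b c b+c≡m+j _ = begin
  [x^ a y^ b z^ c ] (1# * (u ^ n * p))     ≡⟨ coeff-cong _ (*-identityˡ (u ^ n * p)) ⟩
  [x^ a y^ b z^ c ] (u ^ n * p)            ≡⟨ coeff-u^* p-form n a b c ⟩
  + (n C a) ℤ.* [x^ 0 y^ b z^ c ] p
    ≡⟨ cong (+ (n C a) ℤ.*_) (vanishes p-form 0 b c λ (_ , b+c≡j) →
         ℕ.m≢1+n+m j (trans (sym b+c≡j) b+c≡m+j)) ⟩
  + (n C a) ℤ.* 0ℤ                         ≡⟨ ℤ.*-zeroʳ (+ (n C a)) ⟩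
  0ℤ                                       ∎
  where open ≡-Reasoning
coeff-[u+s]^* {p = p} p-form (suc N) n zero n′ a b c b+c≡j n′≡n+N = begin
  [x^ a y^ b z^ c ] ((u + s) ^ suc N * (u ^ n * p))  ≡⟨ coeff-cong _ (split-u+s N n p) ⟩
  [x^ a y^ b z^ c ] ((u + s) ^ N * (u ^ suc n * p) + (u + s) ^ N * (u ^ n * (s * p)))
    ≡⟨ coeff-+ _ ((u + s) ^ N * (u ^ suc n * p)) ((u + s) ^ N * (u ^ n * (s * p))) ⟩
  [x^ a y^ b z^ c ] ((u + s) ^ N * (u ^ suc n * p)) ℤ.+
  [x^ a y^ b z^ c ] ((u + s) ^ N * (u ^ n * (s * p)))
    ≡⟨ cong₂ ℤ._+_
         (coeff-[u+s]^* p-form N (suc n) zero n′ a b c b+c≡j (trans n′≡n+N (ℕ.+-suc n N)))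
         (coeff-below (form-s* p-form) N n a b c (ℕ.s≤s (ℕ.≤-reflexive b+c≡j))) ⟩
  1ℤ ℤ.* (+ (n′ C a) ℤ.* [x^ 0 y^ b z^ c ] (1# * p)) ℤ.+ 0ℤ  ≡⟨ ℤ.+-identityʳ _ ⟩
  1ℤ ℤ.* (+ (n′ C a) ℤ.* [x^ 0 y^ b z^ c ] (1# * p))         ∎
  where open ≡-Reasoning
coeff-[u+s]^* {j} {p} p-form (suc N) n (suc m) n′ a b c b+c≡m+j n′+m≡n+N = begin
  [x^ a y^ b z^ c ] ((u + s) ^ suc N * (u ^ n * p))  ≡⟨ coeff-cong _ (split-u+s N n p) ⟩
  [x^ a y^ b z^ c ] ((u + s) ^ N * (u ^ suc n * p) + (u + s) ^ N * (u ^ n * (s * p)))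
    ≡⟨ coeff-+ _ ((u + s) ^ N * (u ^ suc n * p)) ((u + s) ^ N * (u ^ n * (s * p))) ⟩
  [x^ a y^ b z^ c ] ((u + s) ^ N * (u ^ suc n * p)) ℤ.+
  [x^ a y^ b z^ c ] ((u + s) ^ N * (u ^ n * (s * p)))
    ≡⟨ cong₂ ℤ._+_
         (coeff-[u+s]^* p-form N (suc n) (suc m) n′ a b c b+c≡m+j (trans n′+m≡n+N (ℕ.+-suc n N)))
         (coeff-[u+s]^* (form-s* p-form) N n m n′ a b c
           (trans b+c≡m+j (sym (ℕ.+-suc m j)))
           (ℕ.suc-injective (trans (sym (ℕ.+-suc n′ m)) (trans n′+m≡n+N (ℕ.+-suc n N))))) ⟩
  + (N C suc m) ℤ.* (+ (n′ C a) ℤ.* S) ℤ.+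
  + (N C m) ℤ.* (+ (n′ C a) ℤ.* [x^ 0 y^ b z^ c ] (s ^ m * (s * p)))
    ≡⟨ cong (λ r → + (N C suc m) ℤ.* (+ (n′ C a) ℤ.* S) ℤ.+ + (N C m) ℤ.* (+ (n′ C a) ℤ.* r))
         (coeff-cong _ (≋-trans (≋-sym (*-assoc (s ^ m) s p)) (*-congʳ p (*-comm (s ^ m) s)))) ⟩
  + (N C suc m) ℤ.* (+ (n′ C a) ℤ.* S) ℤ.+ + (N C m) ℤ.* (+ (n′ C a) ℤ.* S)
    ≡⟨ ℤ.*-distribʳ-+ (+ (n′ C a) ℤ.* S) (+ (N C suc m)) (+ (N C m)) ⟨
  + (N C suc m ℕ.+ N C m) ℤ.* (+ (n′ C a) ℤ.* S)
    ≡⟨ cong (λ r → + r ℤ.* (+ (n′ C a) ℤ.* S))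
         (trans (ℕ.+-comm (N C suc m) (N C m)) (nCk+nC[k+1]≡[n+1]C[k+1] N m)) ⟩
  + (suc N C suc m) ℤ.* (+ (n′ C a) ℤ.* S)  ∎
  where
  open ≡-Reasoning
  S = [x^ 0 y^ b z^ c ] (s ^ suc m * p)

-- Central coefficients of the forms s²ⁱ (-d²)ᵏ

coeff-s^* : ∀ m b c → [x^ 0 y^ b z^ c ] (s ^ suc m) ≡
  [x^ 0 y^ b z^ c ] (y * s ^ m) ℤ.+ [x^ 0 y^ b z^ c ] (z * s ^ m)
coeff-s^* m b c = trans (coeff-cong _ (*-distribʳ-+ (s ^ m) y z)) (coeff-+ _ (y * s ^ m) (z * s ^ m))

coeff-s^ : ∀ m b c → b ℕ.+ c ≡ m → [x^ 0 y^ b z^ c ] (s ^ m) ≡ + (m C b)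
coeff-s^ zero    zero    zero    refl  = refl
coeff-s^ (suc m) zero    (suc c) c≡m   = trans (coeff-s^* m 0 (suc c)) (cong₂ ℤ._+_
  (coeff-var*-zero _ (suc zero) (s ^ m) refl)
  (trans (coeff-var*-suc (0 ∷ 0 ∷ c ∷ []) (suc (suc zero)) (s ^ m))
         (coeff-s^ m 0 c (ℕ.suc-injective c≡m))))
coeff-s^ (suc m) (suc b) zero    b+0≡m = trans (coeff-s^* m (suc b) 0) (trans (cong₂ ℤ._+_
  (trans (coeff-var*-suc (0 ∷ b ∷ 0 ∷ []) (suc zero) (s ^ m))
         (coeff-s^ m b 0 (ℕ.suc-injective b+0≡m)))
  (coeff-var*-zero _ (suc (suc zero)) (s ^ m) refl))
  (trans (ℤ.+-identityʳ _) (cong +_ (binomial b≡m))))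
  where
  b≡m : b ≡ m
  b≡m = trans (sym (ℕ.+-identityʳ b)) (ℕ.suc-injective b+0≡m)
  binomial : ∀ {b m} → b ≡ m → m C b ≡ suc m C suc b
  binomial {b} refl = trans (nCn≡1 b) (sym (nCn≡1 (suc b)))
coeff-s^ (suc m) (suc b) (suc c) b+c≡m = trans (coeff-s^* m (suc b) (suc c)) (trans (cong₂ ℤ._+_
  (trans (coeff-var*-suc (0 ∷ b ∷ suc c ∷ []) (suc zero) (s ^ m))
         (coeff-s^ m b (suc c) (ℕ.suc-injective b+c≡m)))
  (trans (coeff-var*-suc (0 ∷ suc b ∷ c ∷ []) (suc (suc zero)) (s ^ m))
         (coeff-s^ m (suc b) c (trans (sym (ℕ.+-suc b c)) (ℕ.suc-injective b+c≡m)))))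
  (cong +_ (nCk+nC[k+1]≡[n+1]C[k+1] m b)))

-- The central coefficient of a form of degree 2n in y and z.
diag : ℕ → Poly 3 → ℤ
diag n p = [x^ 0 y^ n z^ n ] p

diag-yz* : ∀ n p → diag (suc n) ((y * z) * p) ≡ diag n p
diag-yz* n p = trans (coeff-cong _ (*-assoc y z p))
  (trans (coeff-var*-suc (0 ∷ n ∷ suc n ∷ []) (suc zero) (z * p))
         (coeff-var*-suc (0 ∷ n ∷ n ∷ []) (suc (suc zero)) p))

-- The form s²ⁱ (-d²)ᵏ; its coefficient diag (i + k) is the number T(i,k).
F : ℕ → ℕ → Poly 3
F i k = (s ^ 2) ^ i * -d² ^ k

-- s² - d² = 4yz, and multiplication by yz shifts the central coefficient.
F-recurrence : ∀ n i k →
  diag (suc n) (F i (suc k)) ℤ.+ diag (suc n) (F (suc i) k) ≡ + 4 ℤ.* diag n (F i k)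
F-recurrence n i k = begin
  diag (suc n) (F i (suc k)) ℤ.+ diag (suc n) (F (suc i) k)
    ≡⟨ coeff-+ _ (F i (suc k)) (F (suc i) k) ⟨
  diag (suc n) (F i (suc k) + F (suc i) k)
    ≡⟨ coeff-cong _ (q+f-collect (s ^ 2) -d² ((s ^ 2) ^ i) (-d² ^ k)) ⟩
  diag (suc n) ((s ^ 2 + -d²) * G)
    ≡⟨ coeff-cong _ (*-congʳ G ([p+q]²-[p-q]²≋4pq y z)) ⟩
  diag (suc n) (((w + w) + (w + w)) * G)
    ≡⟨ double (w + w) ⟩
  diag (suc n) ((w + w) * G) ℤ.+ diag (suc n) ((w + w) * G)
    ≡⟨ cong₂ ℤ._+_ (double w) (double w) ⟩
  (diag (suc n) (w * G) ℤ.+ diag (suc n) (w * G)) ℤ.+ (diag (suc n) (w * G) ℤ.+ diag (suc n) (w * G))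
    ≡⟨ cong (λ t → (t ℤ.+ t) ℤ.+ (t ℤ.+ t)) (diag-yz* n G) ⟩
  (diag n G ℤ.+ diag n G) ℤ.+ (diag n G ℤ.+ diag n G)
    ≡⟨ quadruple (diag n G) ⟩
  + 4 ℤ.* diag n G ∎
  where
  open ≡-Reasoning
  w = y * z
  G = F i k
  double : ∀ p → diag (suc n) ((p + p) * G) ≡ diag (suc n) (p * G) ℤ.+ diag (suc n) (p * G)
  double p = trans (coeff-cong _ (*-distribʳ-+ G p p)) (coeff-+ _ (p * G) (p * G))
  quadruple : ∀ t → (t ℤ.+ t) ℤ.+ (t ℤ.+ t) ≡ + 4 ℤ.* t
  quadruple = solve-∀

choose-! : ∀ k j → ((k ℕ.+ j) C k) ℕ.* (k ! ℕ.* j !) ≡ (k ℕ.+ j) !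
choose-! k j = begin
  ((k ℕ.+ j) C k) ℕ.* (k ! ℕ.* j !)
    ≡⟨ cong (λ i → ((k ℕ.+ j) C k) ℕ.* (k ! ℕ.* i !)) (ℕ.m+n∸m≡n k j) ⟨
  ((k ℕ.+ j) C k) ℕ.* (k ! ℕ.* (k ℕ.+ j ℕ.∸ k) !)
    ≡⟨ cong (ℕ._* (k ! ℕ.* (k ℕ.+ j ℕ.∸ k) !)) (nCk≡n!/k![n-k]! k≤k+j) ⟩
  (k ℕ.+ j) ! / (k ! ℕ.* (k ℕ.+ j ℕ.∸ k) !) ℕ.* (k ! ℕ.* (k ℕ.+ j ℕ.∸ k) !)
    ≡⟨ m/n*n≡m (k![n∸k]!∣n! k≤k+j) ⟩
  (k ℕ.+ j) ! ∎
  where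
  open ≡-Reasoning
  k≤k+j = ℕ.m≤m+n k j
  instance _ = k ℕ.!* (k ℕ.+ j ℕ.∸ k) !≢0

-- The induction step of diag-F, with t = T(i,k), t₁ = T(i,k+1), t₂ = T(i+1,k),
-- φ = k! i! n!, κ = (2k)! and ι = (2i)!, where n = i + k.  The hypothesis on t₂
-- carries a factor 1 + i that is absent from the conclusion and is cancelled.
diag-F-step : ∀ (i k t t₁ t₂ φ κ ι : ℤ) .{{_ : ℤ.NonZero (1ℤ ℤ.+ i)}} →
  t₁ ℤ.+ t₂ ≡ + 4 ℤ.* t →
  t ℤ.* φ ≡ κ ℤ.* ι →
  t₂ ℤ.* ((1ℤ ℤ.+ i) ℤ.* ((1ℤ ℤ.+ (i ℤ.+ k)) ℤ.* φ))
    ≡ κ ℤ.* ((+ 2 ℤ.+ i ℤ.* + 2) ℤ.* ((1ℤ ℤ.+ i ℤ.* + 2) ℤ.* ι)) →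
  t₁ ℤ.* ((1ℤ ℤ.+ k) ℤ.* ((1ℤ ℤ.+ (i ℤ.+ k)) ℤ.* φ))
    ≡ (+ 2 ℤ.+ k ℤ.* + 2) ℤ.* ((1ℤ ℤ.+ k ℤ.* + 2) ℤ.* κ) ℤ.* ι
diag-F-step i k t t₁ t₂ φ κ ι rec ih ih₂ = ℤ.*-cancelˡ-≡ (1ℤ ℤ.+ i) _ _ (begin
  (1ℤ ℤ.+ i) ℤ.* (t₁ ℤ.* ((1ℤ ℤ.+ k) ℤ.* ((1ℤ ℤ.+ (i ℤ.+ k)) ℤ.* φ)))
    ≡⟨ expand i k t t₁ t₂ φ ⟩
  combination (t₁ ℤ.+ t₂) (t ℤ.* φ) (t₂ ℤ.* ((1ℤ ℤ.+ i) ℤ.* ((1ℤ ℤ.+ (i ℤ.+ k)) ℤ.* φ)))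
    ≡⟨ cong₂ (λ r a → combination r a _) rec ih ⟩
  combination (+ 4 ℤ.* t) (κ ℤ.* ι) (t₂ ℤ.* ((1ℤ ℤ.+ i) ℤ.* ((1ℤ ℤ.+ (i ℤ.+ k)) ℤ.* φ)))
    ≡⟨ cong (combination (+ 4 ℤ.* t) (κ ℤ.* ι)) ih₂ ⟩
  combination (+ 4 ℤ.* t) (κ ℤ.* ι) (κ ℤ.* ((+ 2 ℤ.+ i ℤ.* + 2) ℤ.* ((1ℤ ℤ.+ i ℤ.* + 2) ℤ.* ι)))
    ≡⟨ collect i k t φ κ ι ⟩
  (1ℤ ℤ.+ i) ℤ.* ((+ 2 ℤ.+ k ℤ.* + 2) ℤ.* ((1ℤ ℤ.+ k ℤ.* + 2) ℤ.* κ) ℤ.* ι) ∎)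
  where
  open ≡-Reasoning
  combination : ℤ → ℤ → ℤ → ℤ
  combination r a b =
    (1ℤ ℤ.+ k) ℤ.* ((1ℤ ℤ.+ i) ℤ.* (1ℤ ℤ.+ (i ℤ.+ k))
      ℤ.* ((r ℤ.- + 4 ℤ.* t) ℤ.* φ ℤ.+ + 4 ℤ.* a) ℤ.- b)
  expand : ∀ i k t t₁ t₂ φ →
    (1ℤ ℤ.+ i) ℤ.* (t₁ ℤ.* ((1ℤ ℤ.+ k) ℤ.* ((1ℤ ℤ.+ (i ℤ.+ k)) ℤ.* φ)))
    ≡ (1ℤ ℤ.+ k) ℤ.* ((1ℤ ℤ.+ i) ℤ.* (1ℤ ℤ.+ (i ℤ.+ k))
      ℤ.* ((t₁ ℤ.+ t₂ ℤ.- + 4 ℤ.* t) ℤ.* φ ℤ.+ + 4 ℤ.* (t ℤ.* φ))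
      ℤ.- t₂ ℤ.* ((1ℤ ℤ.+ i) ℤ.* ((1ℤ ℤ.+ (i ℤ.+ k)) ℤ.* φ)))
  expand = solve-∀
  collect : ∀ i k t φ κ ι →
    (1ℤ ℤ.+ k) ℤ.* ((1ℤ ℤ.+ i) ℤ.* (1ℤ ℤ.+ (i ℤ.+ k))
      ℤ.* ((+ 4 ℤ.* t ℤ.- + 4 ℤ.* t) ℤ.* φ ℤ.+ + 4 ℤ.* (κ ℤ.* ι))
      ℤ.- κ ℤ.* ((+ 2 ℤ.+ i ℤ.* + 2) ℤ.* ((1ℤ ℤ.+ i ℤ.* + 2) ℤ.* ι)))
    ≡ (1ℤ ℤ.+ i) ℤ.* ((+ 2 ℤ.+ k ℤ.* + 2) ℤ.* ((1ℤ ℤ.+ k ℤ.* + 2) ℤ.* κ) ℤ.* ι)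
  collect = solve-∀

pos-[2+2n]! : ∀ n →
  + ((suc n ℕ.* 2) !) ≡ (+ 2 ℤ.+ + n ℤ.* + 2) ℤ.* ((1ℤ ℤ.+ + n ℤ.* + 2) ℤ.* + ((n ℕ.* 2) !))
pos-[2+2n]! n = begin
  + ((suc n ℕ.* 2) !)
    ≡⟨ ℤ.pos-* (2 ℕ.+ n ℕ.* 2) ((1 ℕ.+ n ℕ.* 2) !) ⟩
  (+ 2 ℤ.+ + (n ℕ.* 2)) ℤ.* + ((1 ℕ.+ n ℕ.* 2) !)
    ≡⟨ cong ((+ 2 ℤ.+ + (n ℕ.* 2)) ℤ.*_) (ℤ.pos-* (1 ℕ.+ n ℕ.* 2) ((n ℕ.* 2) !)) ⟩
  (+ 2 ℤ.+ + (n ℕ.* 2)) ℤ.* ((1ℤ ℤ.+ + (n ℕ.* 2)) ℤ.* + ((n ℕ.* 2) !))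
    ≡⟨ cong (λ m → (+ 2 ℤ.+ m) ℤ.* ((1ℤ ℤ.+ m) ℤ.* + ((n ℕ.* 2) !))) (ℤ.pos-* n 2) ⟩
  (+ 2 ℤ.+ + n ℤ.* + 2) ℤ.* ((1ℤ ℤ.+ + n ℤ.* + 2) ℤ.* + ((n ℕ.* 2) !)) ∎
  where open ≡-Reasoning

-- T(i,k) k! i! (i+k)! = (2k)! (2i)!
diag-F : ∀ k i → diag (i ℕ.+ k) (F i k) ℤ.* + (k ! ℕ.* (i ! ℕ.* (i ℕ.+ k) !))
               ≡ + ((k ℕ.* 2) !) ℤ.* + ((i ℕ.* 2) !)
diag-F zero i = begin
  diag (i ℕ.+ 0) (F i 0) ℤ.* + (1 ℕ.* (i ! ℕ.* (i ℕ.+ 0) !))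
    ≡⟨ cong₂ (λ j m → diag j (F i 0) ℤ.* + m) (ℕ.+-identityʳ i)
         (trans (ℕ.*-identityˡ _) (cong (λ j → i ! ℕ.* j !) (ℕ.+-identityʳ i))) ⟩
  diag i (F i 0) ℤ.* + (i ! ℕ.* i !)
    ≡⟨ cong (ℤ._* + (i ! ℕ.* i !)) (trans
         (coeff-cong _ (≋-trans (*-identityʳ ((s ^ 2) ^ i)) (^-assocʳ s 2 i)))
         (coeff-s^ (2 ℕ.* i) i i (cong (i ℕ.+_) (sym (ℕ.+-identityʳ i))))) ⟩
  + ((2 ℕ.* i) C i) ℤ.* + (i ! ℕ.* i !)
    ≡⟨ ℤ.pos-* ((2 ℕ.* i) C i) (i ! ℕ.* i !) ⟨
  + (((2 ℕ.* i) C i) ℕ.* (i ! ℕ.* i !))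
    ≡⟨ cong (λ j → + (((i ℕ.+ j) C i) ℕ.* (i ! ℕ.* i !))) (ℕ.+-identityʳ i) ⟩
  + (((i ℕ.+ i) C i) ℕ.* (i ! ℕ.* i !))
    ≡⟨ cong +_ (choose-! i i) ⟩
  + ((i ℕ.+ i) !)
    ≡⟨ cong (λ j → + (j !)) (trans (cong (i ℕ.+_) (sym (ℕ.+-identityʳ i))) (ℕ.*-comm 2 i)) ⟩
  + ((i ℕ.* 2) !)
    ≡⟨ ℤ.*-identityˡ _ ⟨
  1ℤ ℤ.* + ((i ℕ.* 2) !) ∎
  where open ≡-Reasoning
diag-F (suc k) i rewrite ℕ.+-suc i k = begin
  diag (suc n) (F i (suc k)) ℤ.* + ((suc k) ! ℕ.* (i ! ℕ.* (suc n) !))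
    ≡⟨ cong (diag (suc n) (F i (suc k)) ℤ.*_) (trans (cong +_ (left k n (k !) (i !) (n !)))
         (pos-suc*² k n _)) ⟩
  diag (suc n) (F i (suc k)) ℤ.* ((1ℤ ℤ.+ + k) ℤ.* ((1ℤ ℤ.+ (+ i ℤ.+ + k)) ℤ.* φ))
    ≡⟨ diag-F-step (+ i) (+ k) (diag n (F i k))
         (diag (suc n) (F i (suc k))) (diag (suc n) (F (suc i) k))
         φ (+ ((k ℕ.* 2) !)) (+ ((i ℕ.* 2) !))
         (F-recurrence n i k) (diag-F k i)
         (trans (cong (diag (suc n) (F (suc i) k) ℤ.*_)
                  (sym (trans (cong +_ (middle i n (k !) (i !) (n !))) (pos-suc*² i n _))))
           (trans (diag-F k (suc i)) (cong (+ ((k ℕ.* 2) !) ℤ.*_) (pos-[2+2n]! i)))) ⟩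
  (+ 2 ℤ.+ + k ℤ.* + 2) ℤ.* ((1ℤ ℤ.+ + k ℤ.* + 2) ℤ.* + ((k ℕ.* 2) !)) ℤ.* + ((i ℕ.* 2) !)
    ≡⟨ cong (ℤ._* + ((i ℕ.* 2) !)) (pos-[2+2n]! k) ⟨
  + ((suc k ℕ.* 2) !) ℤ.* + ((i ℕ.* 2) !) ∎
  where
  open ≡-Reasoning
  n = i ℕ.+ k
  φ = + (k ! ℕ.* (i ! ℕ.* n !))
  pos-suc*² : ∀ a b m → + (suc a ℕ.* (suc b ℕ.* m)) ≡ (1ℤ ℤ.+ + a) ℤ.* ((1ℤ ℤ.+ + b) ℤ.* + m)
  pos-suc*² a b m = trans (ℤ.pos-* (suc a) (suc b ℕ.* m)) (cong ((1ℤ ℤ.+ + a) ℤ.*_) (ℤ.pos-* (suc b) m))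
  left : ∀ k n a b c →
    (suc k ℕ.* a) ℕ.* (b ℕ.* (suc n ℕ.* c)) ≡ suc k ℕ.* (suc n ℕ.* (a ℕ.* (b ℕ.* c)))
  left = ℕ-Solver.solve-∀
  middle : ∀ i n a b c →
    a ℕ.* ((suc i ℕ.* b) ℕ.* (suc n ℕ.* c)) ≡ suc i ℕ.* (suc n ℕ.* (a ℕ.* (b ℕ.* c)))
  middle = ℕ-Solver.solve-∀

-- C(2n,2i) T(i,k) = C(2n,n) C(n,k): multiplied by k! i! n!, both sides are (2n)!.
C-diag-F : ∀ k i → let n = i ℕ.+ k in
  + ((n ℕ.* 2) C (i ℕ.* 2)) ℤ.* diag n (F i k) ≡ + ((n ℕ.* 2) C n) ℤ.* + (n C k)
C-diag-F k i = ℤ.*-cancelʳ-≡ _ _ (+ (k ! ℕ.* (i ! ℕ.* n !))) (begin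
  + ((n ℕ.* 2) C (i ℕ.* 2)) ℤ.* diag n (F i k) ℤ.* + (k ! ℕ.* (i ! ℕ.* n !))
    ≡⟨ ℤ.*-assoc (+ ((n ℕ.* 2) C (i ℕ.* 2))) _ _ ⟩
  + ((n ℕ.* 2) C (i ℕ.* 2)) ℤ.* (diag n (F i k) ℤ.* + (k ! ℕ.* (i ! ℕ.* n !)))
    ≡⟨ cong (+ ((n ℕ.* 2) C (i ℕ.* 2)) ℤ.*_) (diag-F k i) ⟩
  + ((n ℕ.* 2) C (i ℕ.* 2)) ℤ.* (+ ((k ℕ.* 2) !) ℤ.* + ((i ℕ.* 2) !))
    ≡⟨ pos-*³ ((n ℕ.* 2) C (i ℕ.* 2)) ((k ℕ.* 2) !) ((i ℕ.* 2) !) ⟨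
  + (((n ℕ.* 2) C (i ℕ.* 2)) ℕ.* ((k ℕ.* 2) ! ℕ.* (i ℕ.* 2) !))
    ≡⟨ cong +_ factorials ⟩
  + (((n ℕ.* 2) C n) ℕ.* ((n C k) ℕ.* (k ! ℕ.* (i ! ℕ.* n !))))
    ≡⟨ pos-*³ ((n ℕ.* 2) C n) (n C k) (k ! ℕ.* (i ! ℕ.* n !)) ⟩
  + ((n ℕ.* 2) C n) ℤ.* (+ (n C k) ℤ.* + (k ! ℕ.* (i ! ℕ.* n !)))
    ≡⟨ ℤ.*-assoc (+ ((n ℕ.* 2) C n)) _ _ ⟨
  + ((n ℕ.* 2) C n) ℤ.* + (n C k) ℤ.* + (k ! ℕ.* (i ! ℕ.* n !)) ∎)
  where
  open ≡-Reasoning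
  n = i ℕ.+ k
  instance
    _ = k ℕ.!≢0
    _ = i ℕ.!* n !≢0
    _ = ℕ.m*n≢0 (k !) (i ! ℕ.* n !)
  pos-*³ : ∀ a b c → + (a ℕ.* (b ℕ.* c)) ≡ + a ℤ.* (+ b ℤ.* + c)
  pos-*³ a b c = trans (ℤ.pos-* a (b ℕ.* c)) (cong (+ a ℤ.*_) (ℤ.pos-* b c))
  regroup : ∀ a b k i n → a ℕ.* ((b ℕ.* (k ℕ.* i)) ℕ.* n) ≡ a ℕ.* (b ℕ.* (k ℕ.* (i ℕ.* n)))
  regroup = ℕ-Solver.solve-∀
  double : n ℕ.+ n ≡ n ℕ.* 2
  double = lemma n
    where
    lemma : ∀ n → n ℕ.+ n ≡ n ℕ.* 2
    lemma = ℕ-Solver.solve-∀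
  factorials : ((n ℕ.* 2) C (i ℕ.* 2)) ℕ.* ((k ℕ.* 2) ! ℕ.* (i ℕ.* 2) !)
             ≡ ((n ℕ.* 2) C n) ℕ.* ((n C k) ℕ.* (k ! ℕ.* (i ! ℕ.* n !)))
  factorials = begin
    ((n ℕ.* 2) C (i ℕ.* 2)) ℕ.* ((k ℕ.* 2) ! ℕ.* (i ℕ.* 2) !)
      ≡⟨ cong₂ (λ m r → (m C (i ℕ.* 2)) ℕ.* r) (ℕ.*-distribʳ-+ 2 i k)
           (ℕ.*-comm ((k ℕ.* 2) !) ((i ℕ.* 2) !)) ⟩
    ((i ℕ.* 2 ℕ.+ k ℕ.* 2) C (i ℕ.* 2)) ℕ.* ((i ℕ.* 2) ! ℕ.* (k ℕ.* 2) !)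
      ≡⟨ choose-! (i ℕ.* 2) (k ℕ.* 2) ⟩
    (i ℕ.* 2 ℕ.+ k ℕ.* 2) !
      ≡⟨ cong _! (trans (sym (ℕ.*-distribʳ-+ 2 i k)) (sym double)) ⟩
    (n ℕ.+ n) !
      ≡⟨ choose-! n n ⟨
    ((n ℕ.+ n) C n) ℕ.* (n ! ℕ.* n !)
      ≡⟨ cong₂ (λ m r → (m C n) ℕ.* (r ℕ.* n !)) double n! ⟩
    ((n ℕ.* 2) C n) ℕ.* ((n C k) ℕ.* (k ! ℕ.* i !) ℕ.* n !)
      ≡⟨ regroup ((n ℕ.* 2) C n) (n C k) (k !) (i !) (n !) ⟩
    ((n ℕ.* 2) C n) ℕ.* ((n C k) ℕ.* (k ! ℕ.* (i ! ℕ.* n !))) ∎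
    where
    n! : n ! ≡ (n C k) ℕ.* (k ! ℕ.* i !)
    n! = trans (cong _! (ℕ.+-comm i k)) (trans (sym (choose-! k i))
           (cong (λ m → (m C k) ℕ.* (k ! ℕ.* i !)) (ℕ.+-comm k i)))

-- The coefficient in the theorem

-- At i = k = 0 and m = n this is the polynomial of the theorem; m counts the factors
-- u² - d² still to be distributed.
W : ℕ → ℕ → ℕ → ℕ → Poly 3
W n i k m = (u + s) ^ (n ℕ.* 2) * ((u ^ 2) ^ i * -d² ^ k * (u ^ 2 + -d²) ^ m)

-- At m = 0 the value is C(2n,n)² C(n,k), and each further factor is one application
-- of Pascal's rule.
coeff-W : ∀ m i k n → i ℕ.+ k ℕ.+ m ≡ n →
  [x^ n y^ n z^ n ] (W n i k m)
    ≡ + (((n ℕ.* 2) C n) ℕ.* ((n ℕ.* 2) C n)) ℤ.* + ((m ℕ.+ n) C (m ℕ.+ k))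
coeff-W zero i k n i+k+0≡n with refl ← trans (sym (ℕ.+-identityʳ (i ℕ.+ k))) i+k+0≡n = begin
  [x^ n y^ n z^ n ] (W n i k 0)
    ≡⟨ coeff-cong _ (*-congˡ ((u + s) ^ (n ℕ.* 2)) (≋-trans (*-identityʳ ((u ^ 2) ^ i * -d² ^ k))
         (*-congʳ (-d² ^ k) (^-assocʳ u 2 i)))) ⟩
  [x^ n y^ n z^ n ] ((u + s) ^ (n ℕ.* 2) * (u ^ (2 ℕ.* i) * -d² ^ k))
    ≡⟨ coeff-[u+s]^* (form-d²^ k) (n ℕ.* 2) (2 ℕ.* i) (i ℕ.* 2) (n ℕ.* 2) n n n
         (degree i k) (exponent i (i ℕ.+ k)) ⟩
  + ((n ℕ.* 2) C (i ℕ.* 2)) ℤ.* (c ℤ.* diag n (s ^ (i ℕ.* 2) * -d² ^ k))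
    ≡⟨ cong (λ t → + ((n ℕ.* 2) C (i ℕ.* 2)) ℤ.* (c ℤ.* t)) (coeff-cong _ (*-congʳ (-d² ^ k)
         (≋-trans (≡⇒≋ (cong (s ^_) (ℕ.*-comm i 2))) (≋-sym (^-assocʳ s 2 i))))) ⟩
  + ((n ℕ.* 2) C (i ℕ.* 2)) ℤ.* (c ℤ.* diag n (F i k))
    ≡⟨ x∙yz≈y∙xz (+ ((n ℕ.* 2) C (i ℕ.* 2))) c (diag n (F i k)) ⟩
  c ℤ.* (+ ((n ℕ.* 2) C (i ℕ.* 2)) ℤ.* diag n (F i k))
    ≡⟨ cong (c ℤ.*_) (C-diag-F k i) ⟩
  c ℤ.* (c ℤ.* + (n C k))
    ≡⟨ ℤ.*-assoc c c (+ (n C k)) ⟨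
  c ℤ.* c ℤ.* + (n C k)
    ≡⟨ cong (ℤ._* + (n C k)) (ℤ.pos-* ((n ℕ.* 2) C n) ((n ℕ.* 2) C n)) ⟨
  + (((n ℕ.* 2) C n) ℕ.* ((n ℕ.* 2) C n)) ℤ.* + (n C k) ∎
  where
  open ≡-Reasoning
  c = + ((n ℕ.* 2) C n)
  degree : ∀ i k → (i ℕ.+ k) ℕ.+ (i ℕ.+ k) ≡ i ℕ.* 2 ℕ.+ k ℕ.* 2
  degree = ℕ-Solver.solve-∀
  exponent : ∀ i n → n ℕ.* 2 ℕ.+ i ℕ.* 2 ≡ 2 ℕ.* i ℕ.+ n ℕ.* 2
  exponent = ℕ-Solver.solve-∀
coeff-W (suc m) i k n i+k+m≡n = begin
  [x^ n y^ n z^ n ] (W n i k (suc m))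
    ≡⟨ coeff-cong _ ([u+f]c-split (u ^ 2) -d² ((u + s) ^ (n ℕ.* 2)) ((u ^ 2) ^ i) (-d² ^ k)
         ((u ^ 2 + -d²) ^ m)) ⟩
  [x^ n y^ n z^ n ] (W n (suc i) k m + W n i (suc k) m)
    ≡⟨ coeff-+ _ (W n (suc i) k m) (W n i (suc k) m) ⟩
  [x^ n y^ n z^ n ] (W n (suc i) k m) ℤ.+ [x^ n y^ n z^ n ] (W n i (suc k) m)
    ≡⟨ cong₂ ℤ._+_ (coeff-W m (suc i) k n (trans (sym (ℕ.+-suc (i ℕ.+ k) m)) i+k+m≡n))
                   (coeff-W m i (suc k) n (trans (lemma i k m) i+k+m≡n)) ⟩
  c² ℤ.* + ((m ℕ.+ n) C (m ℕ.+ k)) ℤ.+ c² ℤ.* + ((m ℕ.+ n) C (m ℕ.+ suc k))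
    ≡⟨ ℤ.*-distribˡ-+ c² (+ ((m ℕ.+ n) C (m ℕ.+ k))) (+ ((m ℕ.+ n) C (m ℕ.+ suc k))) ⟨
  c² ℤ.* + ((m ℕ.+ n) C (m ℕ.+ k) ℕ.+ (m ℕ.+ n) C (m ℕ.+ suc k))
    ≡⟨ cong (λ j → c² ℤ.* + ((m ℕ.+ n) C (m ℕ.+ k) ℕ.+ (m ℕ.+ n) C j)) (ℕ.+-suc m k) ⟩
  c² ℤ.* + ((m ℕ.+ n) C (m ℕ.+ k) ℕ.+ (m ℕ.+ n) C suc (m ℕ.+ k))
    ≡⟨ cong (λ j → c² ℤ.* + j) (nCk+nC[k+1]≡[n+1]C[k+1] (m ℕ.+ n) (m ℕ.+ k)) ⟩
  c² ℤ.* + ((suc m ℕ.+ n) C (suc m ℕ.+ k)) ∎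
  where
  open ≡-Reasoning
  c² = + (((n ℕ.* 2) C n) ℕ.* ((n ℕ.* 2) C n))
  lemma : ∀ i k m → i ℕ.+ suc k ℕ.+ m ≡ i ℕ.+ k ℕ.+ suc m
  lemma = ℕ-Solver.solve-∀

corollary4p5 : (n : ℕ) →
    + (((2 ℕ.* n) C n) ℕ.^ 3)
    ≡ coeff (n ∷ n ∷ n ∷ [])
    ((1# + x + y + z) ^ (2 ℕ.* n) * (1# + x + y - z) ^ n * (1# + x - y + z) ^ n)
corollary4p5 n = sym (begin
  [x^ n y^ n z^ n ] ((1# + x + y + z) ^ (2 ℕ.* n) * (1# + x + y - z) ^ n * (1# + x - y + z) ^ n)
    ≡⟨ coeff-cong _ (≋-trans
         (*-assoc ((1# + x + y + z) ^ (2 ℕ.* n)) ((1# + x + y - z) ^ n) ((1# + x - y + z) ^ n))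
         (*-cong factor₁ factor₂)) ⟩
  [x^ n y^ n z^ n ] (W n 0 0 n)
    ≡⟨ coeff-W n 0 0 n refl ⟩
  + (((n ℕ.* 2) C n) ℕ.* ((n ℕ.* 2) C n)) ℤ.* + ((n ℕ.+ n) C (n ℕ.+ 0))
    ≡⟨ ℤ.pos-* (((n ℕ.* 2) C n) ℕ.* ((n ℕ.* 2) C n)) ((n ℕ.+ n) C (n ℕ.+ 0)) ⟨
  + (((n ℕ.* 2) C n) ℕ.* ((n ℕ.* 2) C n) ℕ.* ((n ℕ.+ n) C (n ℕ.+ 0)))
    ≡⟨ cong +_ (cong₂ (λ a b → a ℕ.* a ℕ.* b) (cong (_C n) (ℕ.*-comm n 2))
          (cong₂ _C_ (cong (n ℕ.+_) (sym (ℕ.+-identityʳ n))) (ℕ.+-identityʳ n))) ⟩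
  + (((2 ℕ.* n) C n) ℕ.* ((2 ℕ.* n) C n) ℕ.* ((2 ℕ.* n) C n))
    ≡⟨ cong +_ (cube ((2 ℕ.* n) C n)) ⟩
  + (((2 ℕ.* n) C n) ℕ.^ 3) ∎)
  where
  open ≡-Reasoning
  cube : ∀ a → a ℕ.* a ℕ.* a ≡ a ℕ.* (a ℕ.* (a ℕ.* 1))
  cube = ℕ-Solver.solve-∀
  -- The linear forms are explicit lists of terms: 1# + x + y + z, 1# + x + y - z and
  -- 1# + x - y + z are definitionally equal to u + s, u + d and u - d.
  factor₁ : (1# + x + y + z) ^ (2 ℕ.* n) ≋ (u + s) ^ (n ℕ.* 2)
  factor₁ = ≡⇒≋ (cong ((u + s) ^_) (ℕ.*-comm 2 n))
  linear : (1# + x + y - z) * (1# + x - y + z) ≋ u ^ 2 + -d²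
  linear = difference-of-squares u d
  factor₂ : (1# + x + y - z) ^ n * (1# + x - y + z) ^ n ≋ (u ^ 2) ^ 0 * -d² ^ 0 * (u ^ 2 + -d²) ^ n
  factor₂ = ≋-trans (≋-sym (^-distrib-* (1# + x + y - z) (1# + x - y + z) n))
    (≋-trans (^-congˡ n linear) (≋-sym
      (≋-trans (*-congʳ ((u ^ 2 + -d²) ^ n) (*-identityˡ 1#)) (*-identityˡ ((u ^ 2 + -d²) ^ n)))))
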